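{- Let $n\geq 3$. The number of arithmetical structures on the bident $D_n$ is \[ \lvert\operatorname{Arith}(D_n)\rvert=2C(n-2)+\sum_{m=4}^{n}B(n-3,n-m)\,\lvert\operatorname{SArith}(D_m)\rvert, \] where $C(j)=\frac{1}{j+1}\binom{2j}{j}$ is the $j$-th Catalan number and $B(j,k)=\frac{j-k+1}{j+1}\binom{j+k}{j}$ (for $j\ge k\ge 0$) is a ballot number.
   Context: For $n\ge 3$ let $\ell=n-3$. The bident $D_n$ is the graph with vertices $v_x,v_y,v_0,v_1,\dots,v_\ell$ and edges $v_xv_0$, $v_yv_0$, and $v_{i}v_{i+1}$ for $0\le i\le \ell-1$ (so $D_3$ is the path $v_x v_0 v_y$). For a finite connected graph $G$ with $n$ vertices and adjacency matrix $A$, an arithmetical structure on $G$ is a pair $(\mathbf d,\mathbf r)$ of vectors with positive integer entries indexed by the vertices such that $(\operatorname{diag}(\mathbf d)-A)\mathbf r=\mathbf 0$ and the entries of $\mathbf r$ have no nontrivial common factor. On $D_n$ we write $\mathbf d=(d_x,d_y,d_0,\dots,d_\ell)$, $\mathbf r=(r_x,r_y,r_0,\dots,r_\ell)$. $\operatorname{Arith}(D_n)$ is the set of arithmetical structures on $D_n$. An arithmetical structure on $D_n$ is smooth if $d_x,d_y,d_1,\dots,d_\ell\ge 2$ (no condition on $d_0$); $\operatorname{SArith}(D_m)$ denotes the set of smooth arithmetical structures on $D_m$. -}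

module Defs where

open import Data.Nat using (ℕ; zero; suc; _+_; _*_; _∸_; _≤_; _<_)
open import Data.Nat.Divisibility using (_∣_)
open import Data.Nat.DivMod using (_/_)
open import Data.Nat.Combinatorics using (_C_)
open import Data.Fin using (Fin; toℕ)
open import Data.Vec using (Vec; lookup)
open import Data.List using (List; map; upTo; allFin; length)
open import Data.Nat.ListAction using (sum)
open import Data.List.Membership.Propositional using (_∈_)
open import Data.List.Relation.Unary.Unique.Propositional using (Unique)
open import Data.Product using (Σ; _×_)
open import Relation.Binary.PropositionalEquality using (_≡_)

-- Vertices of the bident D_n are indexed by Fin n:
--   index 0 = v_x, index 1 = v_y, index 2 + i = v_i  (0 ≤ i ≤ n - 3).
-- Edges: v_x v_0 (0-2), v_y v_0 (1-2), v_i v_{i+1} (2+i – 3+i).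

adjℕ : ℕ → ℕ → ℕ
adjℕ 0 2 = 1
adjℕ 2 0 = 1
adjℕ 1 2 = 1
adjℕ 2 1 = 1
adjℕ (suc (suc a)) (suc (suc b)) = adjPath a b
  where
  adjPath : ℕ → ℕ → ℕ
  adjPath zero (suc zero) = 1
  adjPath (suc zero) zero = 1
  adjPath (suc a) (suc b) = adjPath a b
  adjPath _ _ = 0
adjℕ _ _ = 0

adjD : (n : ℕ) → Fin n → Fin n → ℕ
adjD n u v = adjℕ (toℕ u) (toℕ v)

adjApply : (n : ℕ) → Vec ℕ n → Fin n → ℕ
adjApply n r v = sum (map (λ u → adjD n v u * lookup r u) (allFin n))

Structure : ℕ → Set
Structure n = Vec ℕ n × Vec ℕ n

IsArith : (n : ℕ) → Structure n → Set
IsArith n (d Data.Product., r) =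
  ((v : Fin n) → 1 ≤ lookup d v) ×
  ((v : Fin n) → 1 ≤ lookup r v) ×
  -- (diag(d) - A) r = 0
  ((v : Fin n) → lookup d v * lookup r v ≡ adjApply n r v) ×
  ((k : ℕ) → ((v : Fin n) → k ∣ lookup r v) → k ≡ 1)

-- smooth: d_x, d_y, d_1, …, d_ℓ ≥ 2, i.e. every vertex except v_0 (index 2)
IsSmoothArith : (n : ℕ) → Structure n → Set
IsSmoothArith n s@(d Data.Product., r) =
  IsArith n s × ((v : Fin n) → (toℕ v ≡ 2 → Data.Empty.⊥) → 2 ≤ lookup d v)
  where import Data.Empty

HasCard : {A : Set} → (A → Set) → ℕ → Set
HasCard {A} P k =
  Σ (List A) λ L → Unique L × ((x : A) → (x ∈ L → P x) × (P x → x ∈ L)) × length L ≡ k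

catalan : ℕ → ℕ
catalan j = ((j + j) C j) / suc j

ballot : ℕ → ℕ → ℕ
ballot j k = ((suc j ∸ k) * ((j + k) C j)) / suc j

sum4to : ℕ → (ℕ → ℕ) → ℕ
sum4to n f = sum (map (λ i → f (4 + i)) (upTo (n ∸ 3)))

{-# OPTIONS --safe #-}

-- A vertex v_i (i ≥ 1) with d_i = 1 satisfies r_i = r_{i-1} + r_{i+1} (with
-- r_{ℓ+1} = 0), so it can be removed by lowering d at its neighbours. Removing
-- the last such vertex v_{q+1} is a bijection onto the structures on D_{n-1}
-- with d_i ≥ 2 for i > q + 1. Hence the numbers N(n, q) of structures on D_n
-- with d_i ≥ 2 for i > q satisfy N(n, q+1) = N(n, q) + N(n-1, q+1), which is
-- the ballot recurrence: N(n, n-3) is the sum of B(n-3, n-m) N(m, 0).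
--
-- Smoothing is never done at v_x and v_y. Instead, among the structures with
-- d_i ≥ 2 for all i ≥ 1, exactly one has d_x = 1 and one has d_y = 1 if m ≥ 4:
-- the entries r_0 > r_1 > … form an arithmetic progression ending in 1. So
-- N(m, 0) = |SArith(D_m)| + 2 for m ≥ 4, and N(3, 0) = 2. The constants 2 add up
-- to 2 C(n-2), because the ballot numbers B(j, 0), …, B(j, j) sum to C(j+1).
module Submission where

open import Defs
open import Data.Empty using (⊥; ⊥-elim)
open import Data.Fin using (Fin; zero; suc; toℕ; fromℕ<)
open import Data.Fin.Properties using (toℕ-fromℕ<)
open import Data.List using ([]; _∷_; _++_; map; applyUpTo; tabulate)
open import Data.List.Membership.Propositional.Properties using (∈-map⁺; ∈-map⁻; ∈-++⁺ˡ; ∈-++⁺ʳ; ∈-++⁻)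
open import Data.List.Properties using (length-map; length-++; map-tabulate; map-upTo; tabulate-cong)
open import Data.List.Relation.Unary.All using ([]; _∷_)
open import Data.List.Relation.Unary.AllPairs using ([]; _∷_)
open import Data.List.Relation.Unary.Any using (here; there)
import Data.List.Relation.Unary.Unique.Propositional.Properties as Unique
open import Data.Nat using (ℕ; zero; suc; _+_; _*_; _∸_; _≤_; _<_; z≤n; s≤s)
open import Data.Nat.Combinatorics using (_C_; nC1≡n; nCk+nC[k+1]≡[n+1]C[k+1]; k>n⇒nCk≡0)
open import Data.Nat.Divisibility using (_∣_; divides; ∣-refl; ∣1⇒≡1; ∣m∣n⇒∣m+n; ∣m+n∣m⇒∣n; ∣n⇒∣m*n; _∣0)
open import Data.Nat.DivMod using (_/_; m*n/n≡m)
open import Data.Nat.ListAction using (sum)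
open import Data.Nat.Properties
open import Data.Nat.Tactic.RingSolver using (solve-∀)
open import Data.Product using (∃; ∃₂; _×_; _,_; proj₁; proj₂)
open import Data.Sum using (_⊎_; inj₁; inj₂; [_,_])
open import Data.Unit using (⊤; tt)
open import Data.Vec using (Vec; []; _∷_; lookup; replicate)
open import Data.Vec.Properties using (∷-injective)
open import Data.Vec.Relation.Unary.All using (All; []; _∷_)
open import Data.Vec.Relation.Unary.All.Properties using (lookup⁺; lookup⁻)
open import Function using (_∘_; id)
open import Relation.Binary.PropositionalEquality using (_≡_; _≢_; refl; sym; trans; cong; cong₂; subst; module ≡-Reasoning)
open import Relation.Nullary using (¬_)

-- The ballot numbers

-- Entry (q, c) is N(q + c + 2, q), where s i is N(i + 3, 0). Column 0 repeats
-- column 1 of the row above, as there is no condition left when q ≥ n - 3.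
triangle : (ℕ → ℕ) → ℕ → ℕ → ℕ
triangle s zero    zero    = 0
triangle s zero    (suc c) = s c
triangle s (suc q) zero    = triangle s q 1
triangle s (suc q) (suc c) = triangle s q (2 + c) + triangle s (suc q) c

-- The Kronecker delta. As initial row of `triangle` it isolates the coefficient of a single `s i`.
δ : ℕ → ℕ → ℕ
δ zero    zero    = 1
δ zero    (suc _) = 0
δ (suc _) zero    = 0
δ (suc i) (suc j) = δ i j

δ-refl : ∀ i → δ i i ≡ 1
δ-refl zero    = refl
δ-refl (suc i) = δ-refl i

δ-< : ∀ {i j} → i < j → δ i j ≡ 0
δ-< {zero}  (s≤s _)   = refl
δ-< {suc i} (s≤s i<j) = δ-< i<j

δ-> : ∀ {i j} → j < i → δ i j ≡ 0
δ-> {suc i} {zero}  _         = refl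
δ-> {suc i} {suc j} (s≤s j<i) = δ-> j<i

-- Every step of the recurrence keeps or lowers q + c, and entry (0, c + 1) is `s c`; so entry (q,
-- c) involves only `s k` with k < q + c.
triangle-δ-≡0 : ∀ i q c → q + c ≤ i → triangle (δ i) q c ≡ 0
triangle-δ-≡0 i zero    zero    _ = refl
triangle-δ-≡0 i zero    (suc c) p = δ-> p
triangle-δ-≡0 i (suc q) zero    p =
  triangle-δ-≡0 i q 1 (≤-trans (≤-reflexive (+-suc q 0)) p)
triangle-δ-≡0 i (suc q) (suc c) p = cong₂ _+_
  (triangle-δ-≡0 i q (2 + c) (≤-trans (≤-reflexive (+-suc q (suc c))) p))
  (triangle-δ-≡0 i (suc q) c (≤-trans (+-monoʳ-≤ (suc q) (n≤1+n c)) p))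

triangle-δ-row₁ : ∀ {i c} → i ≤ c → triangle (δ i) 1 c ≡ 1
triangle-δ-row₁ {c = zero} z≤n = refl
triangle-δ-row₁ {i} {suc c} i≤1+c with m≤n⇒m<n∨m≡n i≤1+c
... | inj₁ (s≤s i≤c) = cong₂ _+_ (δ-< {i} (s≤s i≤c)) (triangle-δ-row₁ i≤c)
... | inj₂ refl      = cong₂ _+_ (δ-refl c) (triangle-δ-≡0 (suc c) 1 c ≤-refl)

-- The reflection principle: the triangle counts lattice paths below a
-- diagonal, and the second binomial coefficient counts the paths that cross it.
triangle-δ : ∀ i q c M → M + i ≡ q + q + c →
  triangle (δ i) (suc q) c + M C (suc q + c) ≡ M C q
triangle-δ i zero c M p = cong₂ _+_
  (triangle-δ-row₁ (≤-trans (m≤n+m i M) (≤-reflexive p)))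
  (k>n⇒nCk≡0 (s≤s (≤-trans (m≤m+n M i) (≤-reflexive p))))
-- With M = 0 the hypothesis puts i at 2q + 2 + c, out of reach of the entry, and both binomial
-- coefficients are 0.
triangle-δ i (suc q) c zero refl = trans (+-identityʳ _)
  (triangle-δ-≡0 i (2 + q) c (+-monoˡ-≤ c (s≤s (m≤n+m (suc q) q))))
-- Column 0 lacks the second summand. The formula agrees, since at column -1 it would give M C (q +
-- 1) - M C (q + 1) = 0.
triangle-δ i (suc q) zero (suc M) p = begin
  t + suc M C (2 + q + 0)              ≡⟨ cong (λ x → t + suc M C x) (+-identityʳ (2 + q)) ⟩
  t + suc M C (2 + q)                  ≡⟨ cong (t +_) (nCk+nC[k+1]≡[n+1]C[k+1] M (suc q)) ⟨
  t + (M C suc q + M C (2 + q))        ≡⟨ cong (λ x → t + (M C suc q + M C suc x)) (+-comm q 1) ⟨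
  t + (M C suc q + M C (suc q + 1))    ≡⟨ shuffle t _ _ ⟩
  (t + M C (suc q + 1)) + M C suc q    ≡⟨ cong (_+ M C suc q) (triangle-δ i q 1 M p′) ⟩
  M C q + M C suc q                    ≡⟨ nCk+nC[k+1]≡[n+1]C[k+1] M q ⟩
  suc M C suc q                        ∎
  where
  open ≡-Reasoning
  t = triangle (δ i) (suc q) 1
  shuffle : ∀ a b c → a + (b + c) ≡ (a + c) + b
  shuffle = solve-∀
  p′ : M + i ≡ q + q + 1
  p′ = trans (suc-injective p) (sumq q)
    where
    sumq : ∀ q → q + suc q + 0 ≡ q + q + 1
    sumq = solve-∀
triangle-δ i (suc q) (suc c) (suc M) p = begin
  (t + u) + suc M C (2 + q + suc c)
    ≡⟨ cong ((t + u) +_) (nCk+nC[k+1]≡[n+1]C[k+1] M (suc q + suc c)) ⟨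
  (t + u) + (M C (suc q + suc c) + M C (2 + q + suc c))
    ≡⟨ cong₂ (λ x y → (t + u) + (M C x + M C y)) (+-suc (suc q) c) (sym (+-suc (suc q) (suc c))) ⟩
  (t + u) + (M C (2 + q + c) + M C (suc q + (2 + c)))
    ≡⟨ shuffle t u _ _ ⟩
  (t + M C (suc q + (2 + c))) + (u + M C (2 + q + c))
    ≡⟨ cong₂ _+_ (triangle-δ i q (2 + c) M (trans (suc-injective p) (sumq₁ q c)))
                 (triangle-δ i (suc q) c M (trans (suc-injective p) (sumq₂ q c))) ⟩
  M C q + M C suc q
    ≡⟨ nCk+nC[k+1]≡[n+1]C[k+1] M q ⟩
  suc M C suc q ∎
  where
  open ≡-Reasoning
  t = triangle (δ i) (suc q) (2 + c)
  u = triangle (δ i) (2 + q) c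
  shuffle : ∀ a b c d → (a + b) + (c + d) ≡ (a + d) + (b + c)
  shuffle = solve-∀
  sumq₁ : ∀ q c → q + suc q + suc c ≡ q + q + (2 + c)
  sumq₁ = solve-∀
  sumq₂ : ∀ q c → q + suc q + suc c ≡ suc q + suc q + c
  sumq₂ = solve-∀

-- Subtraction-free absorption identity. It turns the difference of binomials given by reflection
-- into the quotient form of the ballot number.
C-absorption : ∀ n k → suc k * (n C suc k) + k * (n C k) ≡ n * (n C k)
C-absorption zero zero    = refl
C-absorption zero (suc k) = cong₂ _+_ (*-zeroʳ k) (*-zeroʳ k)
C-absorption (suc n) zero = begin
  1 * (suc n C 1) + 0  ≡⟨ +-identityʳ _ ⟩
  1 * (suc n C 1)      ≡⟨ *-identityˡ _ ⟩
  suc n C 1            ≡⟨ nC1≡n (suc n) ⟩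
  suc n                ≡⟨ *-identityʳ (suc n) ⟨
  suc n * 1            ∎
  where open ≡-Reasoning
C-absorption (suc n) (suc k) = begin
  (2 + k) * (suc n C (2 + k)) + suc k * (suc n C suc k)
    ≡⟨ cong₂ (λ x y → (2 + k) * x + suc k * y)
         (nCk+nC[k+1]≡[n+1]C[k+1] n (suc k)) (nCk+nC[k+1]≡[n+1]C[k+1] n k) ⟨
  (2 + k) * (b + c) + suc k * (a + b)
    ≡⟨ regroup k a b c ⟩
  ((2 + k) * c + suc k * b) + (suc k * b + k * a) + (a + b)
    ≡⟨ cong₂ (λ x y → x + y + (a + b)) (C-absorption n (suc k)) (C-absorption n k) ⟩
  n * b + n * a + (a + b)
    ≡⟨ collect n a b ⟩
  suc n * (a + b)
    ≡⟨ cong (suc n *_) (nCk+nC[k+1]≡[n+1]C[k+1] n k) ⟩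
  suc n * (suc n C suc k) ∎
  where
  open ≡-Reasoning
  a = n C k
  b = n C suc k
  c = n C (2 + k)
  regroup : ∀ k a b c → (2 + k) * (b + c) + suc k * (a + b)
                      ≡ ((2 + k) * c + suc k * b) + (suc k * b + k * a) + (a + b)
  regroup = solve-∀
  collect : ∀ n a b → n * b + n * a + (a + b) ≡ suc n * (a + b)
  collect = solve-∀

-- Reflection gives x = C(j+k, j) - C(j+k, j+1), and absorption gives (j+1) C(j+k, j+1) = k C(j+k,
-- j). Hence (j+1) x = (j+1-k) C(j+k, j), and the division in `ballot` is exact.
ballot-triangle : ∀ j k i → k + i ≡ j → ballot j k ≡ triangle (δ i) (suc j) 0
ballot-triangle j k i p = begin
  ((suc j ∸ k) * y) / suc j             ≡⟨ cong (_/ suc j) numerator ⟩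
  (x * suc j) / suc j                   ≡⟨ m*n/n≡m x (suc j) ⟩
  x                                     ∎
  where
  open ≡-Reasoning
  x = triangle (δ i) (suc j) 0
  y = (j + k) C j
  z = (j + k) C suc j
  x+z≡y : x + z ≡ y
  x+z≡y = trans (cong (λ m → x + (j + k) C m) (sym (+-identityʳ (suc j))))
    (triangle-δ i j 0 (j + k)
      (trans (+-assoc j k i) (trans (cong (j +_) p) (sym (+-identityʳ (j + j))))))
  z*[1+j]≡k*y : suc j * z ≡ k * y
  z*[1+j]≡k*y = +-cancelʳ-≡ (j * y) (suc j * z) (k * y) (begin
    suc j * z + j * y  ≡⟨ C-absorption (j + k) j ⟩
    (j + k) * y        ≡⟨ *-distribʳ-+ y j k ⟩
    j * y + k * y      ≡⟨ +-comm (j * y) (k * y) ⟩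
    k * y + j * y      ∎)
  numerator : (suc j ∸ k) * y ≡ x * suc j
  numerator = begin
    (suc j ∸ k) * y                      ≡⟨ *-distribʳ-∸ y (suc j) k ⟩
    suc j * y ∸ k * y                    ≡⟨ cong₂ (λ u v → suc j * u ∸ v) x+z≡y z*[1+j]≡k*y ⟨
    suc j * (x + z) ∸ suc j * z          ≡⟨ cong (_∸ suc j * z) (*-distribˡ-+ (suc j) x z) ⟩
    suc j * x + suc j * z ∸ suc j * z    ≡⟨ m+n∸n≡m (suc j * x) (suc j * z) ⟩
    suc j * x                            ≡⟨ *-comm (suc j) x ⟩
    x * suc j                            ∎

-- Row 1 of `triangle (δ 0)` is constantly 1, so it can serve as the initial row. The statement
-- starts at row 1 because the initial rows differ at column 0.
triangle-1 : ∀ q c → triangle (λ _ → 1) (suc q) c ≡ triangle (δ 0) (2 + q) c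
triangle-1 zero    zero    = refl
triangle-1 zero    (suc c) = cong₂ _+_ (sym (triangle-δ-row₁ {c = 2 + c} z≤n)) (triangle-1 zero c)
triangle-1 (suc q) zero    = triangle-1 q 1
triangle-1 (suc q) (suc c) = cong₂ _+_ (triangle-1 q (2 + c)) (triangle-1 (suc q) c)

catalan-triangle : ∀ j → triangle (λ _ → 1) (suc j) 0 ≡ catalan (suc j)
catalan-triangle j = begin
  triangle (λ _ → 1) (suc j) 0            ≡⟨ triangle-1 j 0 ⟩
  triangle (δ 0) (suc J) 0                ≡⟨ ballot-triangle J J 0 (+-identityʳ J) ⟨
  ((suc J ∸ J) * ((J + J) C J)) / suc J   ≡⟨ cong (λ x → x * ((J + J) C J) / suc J) (m+n∸n≡m 1 J) ⟩
  (1 * ((J + J) C J)) / suc J             ≡⟨ cong (_/ suc J) (*-identityˡ ((J + J) C J)) ⟩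
  catalan J                               ∎
  where
  open ≡-Reasoning
  J = suc j

-- Linearity in the initial row

triangle-affine : ∀ k s q c →
  triangle (λ i → k + s i) q c ≡ k * triangle (λ _ → 1) q c + triangle s q c
triangle-affine k s zero    zero    = sym (cong (_+ 0) (*-zeroʳ k))
triangle-affine k s zero    (suc c) = sym (cong (_+ s c) (*-identityʳ k))
triangle-affine k s (suc q) zero    = triangle-affine k s q 1
triangle-affine k s (suc q) (suc c) = trans
  (cong₂ _+_ (triangle-affine k s q (2 + c)) (triangle-affine k s (suc q) c))
  (collect k _ _ _ _)
  where
  collect : ∀ k a b c d → (k * a + b) + (k * c + d) ≡ k * (a + c) + (b + d)
  collect = solve-∀

sum-applyUpTo-cong : ∀ {f g} n → (∀ i → i < n → f i ≡ g i) → sum (applyUpTo f n) ≡ sum (applyUpTo g n)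
sum-applyUpTo-cong zero    _   = refl
sum-applyUpTo-cong (suc n) f≗g = cong₂ _+_ (f≗g 0 (s≤s z≤n)) (sum-applyUpTo-cong n (λ i i<n → f≗g (suc i) (s≤s i<n)))

sum-applyUpTo-+ : ∀ f g n → sum (applyUpTo f n) + sum (applyUpTo g n) ≡ sum (applyUpTo (λ i → f i + g i) n)
sum-applyUpTo-+ f g zero    = refl
sum-applyUpTo-+ f g (suc n) = trans (interchange (f 0) _ (g 0) _)
  (cong ((f 0 + g 0) +_) (sum-applyUpTo-+ (λ i → f (suc i)) (λ i → g (suc i)) n))
  where
  interchange : ∀ a b c d → (a + b) + (c + d) ≡ (a + c) + (b + d)
  interchange = solve-∀

sum-applyUpTo-0 : ∀ n → sum (applyUpTo (λ _ → 0) n) ≡ 0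
sum-applyUpTo-0 zero    = refl
sum-applyUpTo-0 (suc n) = sum-applyUpTo-0 n

sum-δ : ∀ s {c b} → c < b → sum (applyUpTo (λ i → δ i c * s i) b) ≡ s c
sum-δ s {zero}  {suc b} _         = trans (cong₂ _+_ (*-identityˡ (s 0)) (sum-applyUpTo-0 b)) (+-identityʳ (s 0))
sum-δ s {suc c} {suc b} (s≤s c<b) = sum-δ (λ i → s (suc i)) c<b

-- Superposition of unit sources. A bound b ≥ q + c covers all of them, because entry (q, c) depends
-- on `s i` only for i < q + c.
triangle-linear : ∀ s b q c → q + c ≤ b →
  triangle s q c ≡ sum (applyUpTo (λ i → triangle (δ i) q c * s i) b)
triangle-linear s b zero    zero    _ = sym (sum-applyUpTo-0 b)
triangle-linear s b zero    (suc c) p = sym (sum-δ s p)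
triangle-linear s b (suc q) zero    p =
  triangle-linear s b q 1 (≤-trans (≤-reflexive (+-suc q 0)) p)
triangle-linear s b (suc q) (suc c) p = begin
  triangle s q (2 + c) + triangle s (suc q) c
    ≡⟨ cong₂ _+_ (triangle-linear s b q (2 + c) (≤-trans (≤-reflexive (+-suc q (suc c))) p))
                 (triangle-linear s b (suc q) c (≤-trans (+-monoʳ-≤ (suc q) (n≤1+n c)) p)) ⟩
  sum (applyUpTo (λ i → triangle (δ i) q (2 + c) * s i) b)
    + sum (applyUpTo (λ i → triangle (δ i) (suc q) c * s i) b)
    ≡⟨ sum-applyUpTo-+ _ _ b ⟩
  sum (applyUpTo (λ i → triangle (δ i) q (2 + c) * s i + triangle (δ i) (suc q) c * s i) b)
    ≡⟨ sum-applyUpTo-cong b (λ i _ → *-distribʳ-+ (s i) (triangle (δ i) q (2 + c)) _) ⟨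
  sum (applyUpTo (λ i → triangle (δ i) (suc q) (suc c) * s i) b) ∎
  where open ≡-Reasoning

-- N(i + 3, 0) − 2. At i = 0 this is not |SArith(D₃)| = 1: for D₃ the structures
-- with d_x = 1 and with d_y = 1 coincide.
smoothCount : (ℕ → ℕ) → ℕ → ℕ
smoothCount s zero    = 0
smoothCount s (suc c) = s (4 + c)

triangle-bident : ∀ s j → triangle (λ i → 2 + smoothCount s i) (suc j) 0
  ≡ 2 * catalan (suc j) + sum4to (3 + j) (λ m → ballot j ((3 + j) ∸ m) * s m)
triangle-bident s j = begin
  triangle (λ i → 2 + smoothCount s i) (suc j) 0
    ≡⟨ triangle-affine 2 (smoothCount s) (suc j) 0 ⟩
  2 * triangle (λ _ → 1) (suc j) 0 + triangle (smoothCount s) (suc j) 0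
    ≡⟨ cong₂ (λ x y → 2 * x + y) (catalan-triangle j)
         (triangle-linear (smoothCount s) (suc j) (suc j) 0 (≤-reflexive (+-identityʳ (suc j)))) ⟩
  2 * catalan (suc j) + (triangle (δ 0) (suc j) 0 * 0
    + sum (applyUpTo (λ i → triangle (δ (suc i)) (suc j) 0 * s (4 + i)) j))
    -- The source i = 0 drops out. Source i + 1 belongs to D_m with m = i + 4, and its k is j - (i +
    -- 1) = n - m for n = j + 3.
    ≡⟨ cong₂ (λ x y → 2 * catalan (suc j) + (x + y)) (*-zeroʳ (triangle (δ 0) (suc j) 0))
         (sum-applyUpTo-cong j (λ i i<j → cong (_* s (4 + i))
           (sym (ballot-triangle j (j ∸ suc i) (suc i) (m∸n+n≡m i<j))))) ⟩
  2 * catalan (suc j) + sum (applyUpTo (λ i → ballot j (j ∸ suc i) * s (4 + i)) j)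
    ≡⟨ cong (λ l → 2 * catalan (suc j) + sum l) (map-upTo _ j) ⟨
  2 * catalan (suc j) + sum4to (3 + j) (λ m → ballot j ((3 + j) ∸ m) * s m) ∎
  where open ≡-Reasoning

-- Cardinalities

module _ {A : Set} where

  HasCard-resp : {P Q : A → Set} {k : ℕ} →
    (∀ x → P x → Q x) → (∀ x → Q x → P x) → HasCard P k → HasCard Q k
  HasCard-resp P⇒Q Q⇒P (L , unique , L⇔P , len) =
    L , unique , (λ x → P⇒Q x ∘ proj₁ (L⇔P x) , proj₂ (L⇔P x) ∘ Q⇒P x) , len

  HasCard-⊎ : {P Q : A → Set} {j k : ℕ} → (∀ x → P x → Q x → ⊥) →
    HasCard P j → HasCard Q k → HasCard (λ x → P x ⊎ Q x) (j + k)
  HasCard-⊎ disjoint (L , uL , L⇔P , refl) (M , uM , M⇔Q , refl) =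
    L ++ M ,
    Unique.++⁺ uL uM (λ (x∈L , x∈M) → disjoint _ (proj₁ (L⇔P _) x∈L) (proj₁ (M⇔Q _) x∈M)) ,
    (λ x → [ inj₁ ∘ proj₁ (L⇔P x) , inj₂ ∘ proj₁ (M⇔Q x) ] ∘ ∈-++⁻ L ,
           [ ∈-++⁺ˡ ∘ proj₂ (L⇔P x) , ∈-++⁺ʳ L ∘ proj₂ (M⇔Q x) ]) ,
    length-++ L

  HasCard-pair : {a b : A} → a ≢ b → HasCard (λ x → x ≡ a ⊎ x ≡ b) 2
  HasCard-pair {a} {b} a≢b =
    a ∷ b ∷ [] , (a≢b ∷ []) ∷ [] ∷ [] ,
    (λ x → (λ { (here p) → inj₁ p ; (there (here p)) → inj₂ p }) ,
           [ here , there ∘ here ]) ,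
    refl

HasCard-image : {A B : Set} {P : A → Set} {k : ℕ} (f : A → B) → (∀ {x y} → f x ≡ f y → x ≡ y) →
  HasCard P k → HasCard (λ y → ∃ λ x → P x × y ≡ f x) k
HasCard-image f f-inj (L , unique , L⇔P , refl) =
  map f L , Unique.map⁺ f-inj unique ,
  (λ y → (λ y∈ → let x , x∈L , y≡fx = ∈-map⁻ f y∈ in x , proj₁ (L⇔P x) x∈L , y≡fx) ,
         (λ { (x , Px , refl) → ∈-map⁺ f (proj₂ (L⇔P x) Px) })) ,
  length-map f L

-- The equations of the bident

-- Reads 0 past the end of the path, where there is no neighbour.
hd : ∀ {m} → Vec ℕ m → ℕ
hd []      = 0
hd (r ∷ _) = r

-- The equations at v₀, …, v_ℓ, where p is the sum of the entries at the
-- neighbours of v₀ that lie outside the path.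
Chain : ∀ {m} → ℕ → Vec ℕ m → Vec ℕ m → Set
Chain p []       []       = ⊤
Chain p (d ∷ ds) (r ∷ rs) = d * r ≡ p + hd rs × Chain r ds rs

record Core {m} (dx dy : ℕ) (d : Vec ℕ m) (rx ry : ℕ) (r : Vec ℕ m) : Set where
  constructor core
  field
    eqx       : dx * rx ≡ hd r
    eqy       : dy * ry ≡ hd r
    chain     : Chain (rx + ry) d r
    posx      : 1 ≤ rx
    posy      : 1 ≤ ry
    pos       : All (1 ≤_) r
    coprime : ∀ k → k ∣ rx → k ∣ ry → All (k ∣_) r → k ≡ 1

positive-factor : ∀ {d r n} → 1 ≤ n → d * r ≡ n → 1 ≤ d
positive-factor {zero}  1≤n refl = 1≤n
positive-factor {suc d} _   _    = s≤s z≤n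

-- Every neighbour sum is positive, so no factor in `d` can be 0. This yields the positivity of `d`
-- when a `Core` is turned into an arithmetical structure.
chain-positive : ∀ {m p} {d r : Vec ℕ m} → 1 ≤ p → All (1 ≤_) r → Chain p d r → All (1 ≤_) d
chain-positive {d = []}    {[]}    _   _            _        = []
chain-positive {d = _ ∷ _} {_ ∷ _} 1≤p (1≤r ∷ pos) (eq , ch) =
  positive-factor (≤-trans 1≤p (m≤m+n _ _)) eq ∷ chain-positive 1≤r pos ch

-- The adjacency matrix

pathAdj : ℕ → ℕ → ℕ
pathAdj zero          zero          = 0
pathAdj zero          (suc zero)    = 1
pathAdj zero          (suc (suc _)) = 0
pathAdj (suc a)       (suc b)       = pathAdj a b
pathAdj (suc zero)    zero          = 1
pathAdj (suc (suc _)) zero          = 0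

-- A recursion along the diagonals and its boundary values determine the function. Rows 1 and 2 + a
-- are separate so that each hypothesis holds by computation for `adjPath′`.
pathAdj-unique : (F : ℕ → ℕ → ℕ) →
  F 0 0 ≡ 0 → F 0 1 ≡ 1 → (∀ b → F 0 (2 + b) ≡ 0) →
  F 1 0 ≡ 1 → (∀ a → F (2 + a) 0 ≡ 0) →
  (∀ b → F 1 (suc b) ≡ F 0 b) → (∀ a b → F (2 + a) (suc b) ≡ F (suc a) b) →
  ∀ a b → F a b ≡ pathAdj a b
pathAdj-unique F e₀₀ e₀₁ e₀ e₁₀ e₂₀ e₁ e₂ = go
  where
  go : ∀ a b → F a b ≡ pathAdj a b
  go zero          zero          = e₀₀
  go zero          (suc zero)    = e₀₁
  go zero          (suc (suc b)) = e₀ b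
  go (suc zero)    zero          = e₁₀
  go (suc (suc a)) zero          = e₂₀ a
  go (suc zero)    (suc b)       = trans (e₁ b) (go zero b)
  go (suc (suc a)) (suc b)       = trans (e₂ a b) (go (suc a) b)

private
  3+_ 4+_ : ℕ → ℕ
  3+ a = 3 + a
  4+ a = 4 + a

-- The local function adjPath of Defs is not exported, and takes the arguments
-- of adjℕ as two extra parameters. Generalising over these in a reduct of
-- adjℕ lets unification recover it as the solution for adjPath′; the aliases
-- 3+_ and 4+_ keep the generalisation from applying before the reduction.
mutual
  adjPath′ : ℕ → ℕ → ℕ → ℕ → ℕ
  adjPath′ = _

  adjℕ-path-suc : ∀ a b → adjℕ (4+ a) (3+ b) ≡ pathAdj (suc a) b
  adjℕ-path-suc a b with suc (suc a) | suc b
  ... | x | y with suc a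
  ... | z = pathAdj-unique (adjPath′ x y) refl refl (λ _ → refl) refl (λ _ → refl)
              (λ _ → refl) (λ _ _ → refl) z b

adjℕ-path : ∀ a b → adjℕ (2 + a) (2 + b) ≡ pathAdj a b
adjℕ-path zero          zero                = refl
adjℕ-path zero          (suc zero)          = refl
adjℕ-path zero          (suc (suc b))       = refl
adjℕ-path (suc zero)    zero                = refl
adjℕ-path (suc zero)    (suc zero)          = refl
adjℕ-path (suc zero)    (suc (suc zero))    = refl
adjℕ-path (suc zero)    (suc (suc (suc b))) = refl
adjℕ-path (suc (suc a)) zero                = refl
adjℕ-path (suc (suc a)) (suc b)             = adjℕ-path-suc a b

sum-tabulate-0 : ∀ {n} {f : Fin n → ℕ} → (∀ u → f u ≡ 0) → sum (tabulate f) ≡ 0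
sum-tabulate-0 {zero}  _   = refl
sum-tabulate-0 {suc n} f≗0 = cong₂ _+_ (f≗0 zero) (sum-tabulate-0 (f≗0 ∘ suc))

sum-tabulate-cong : ∀ {n} {f g : Fin n → ℕ} → (∀ u → f u ≡ g u) → sum (tabulate f) ≡ sum (tabulate g)
sum-tabulate-cong f≗g = cong sum (tabulate-cong f≗g)

pathSum : ∀ {m} → ℕ → Vec ℕ m → ℕ
pathSum a r = sum (tabulate (λ u → pathAdj a (toℕ u) * lookup r u))

pathSum-0 : ∀ {m} r (rs : Vec ℕ m) → pathSum 0 (r ∷ rs) ≡ hd rs
pathSum-0 r []        = refl
pathSum-0 r (r′ ∷ rs) = trans
  (cong₂ _+_ (*-identityˡ r′) (sum-tabulate-0 {f = λ u → 0 * lookup rs u} (λ _ → refl)))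
  (+-identityʳ r′)

neighbours : ∀ {m} → ℕ → Vec ℕ m → Fin m → ℕ
neighbours p (r ∷ rs) zero    = p + hd rs
neighbours p (r ∷ rs) (suc v) = neighbours r rs v

-- Here p behaves like the entry of an extra vertex in front of the path: in indices shifted by one
-- it is vertex 0, adjacent only to the first path vertex.
neighbours-pathSum : ∀ {m} p (r : Vec ℕ m) v →
  neighbours p r v ≡ pathAdj (suc (toℕ v)) 0 * p + pathSum (toℕ v) r
neighbours-pathSum p (r ∷ rs) zero    =
  sym (cong₂ _+_ (*-identityˡ p) (pathSum-0 r rs))
neighbours-pathSum p (r ∷ rs) (suc v) = neighbours-pathSum r rs v

adjApply-tabulate : ∀ n r v → adjApply n r v ≡ sum (tabulate (λ u → adjD n v u * lookup r u))
adjApply-tabulate n r v = cong sum (map-tabulate id (λ u → adjD n v u * lookup r u))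

adjApply-leaf : ∀ {m} rx ry (r : Vec ℕ m) v → adjℕ (toℕ v) 0 ≡ 0 → adjℕ (toℕ v) 1 ≡ 0 →
  adjℕ (toℕ v) 2 ≡ 1 → (∀ u → adjℕ (toℕ v) (3 + u) ≡ 0) →
  adjApply (2 + m) (rx ∷ ry ∷ r) v ≡ hd r
adjApply-leaf {m} rx ry r v e₀ e₁ e₂ e₃ = begin
  adjApply (2 + m) (rx ∷ ry ∷ r) v
    ≡⟨ adjApply-tabulate (2 + m) (rx ∷ ry ∷ r) v ⟩
  adjℕ (toℕ v) 0 * rx + (adjℕ (toℕ v) 1 * ry
    + sum (tabulate (λ u → adjℕ (toℕ v) (2 + toℕ u) * lookup r u)))
    ≡⟨ cong₂ (λ x y → x * rx + (y * ry + rest)) e₀ e₁ ⟩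
  sum (tabulate (λ u → adjℕ (toℕ v) (2 + toℕ u) * lookup r u))
    ≡⟨ rest-hd r ⟩
  hd r ∎
  where
  open ≡-Reasoning
  rest = sum (tabulate (λ u → adjℕ (toℕ v) (2 + toℕ u) * lookup r u))
  rest-hd : ∀ {l} (r : Vec ℕ l) → sum (tabulate (λ u → adjℕ (toℕ v) (2 + toℕ u) * lookup r u)) ≡ hd r
  rest-hd []       = refl
  rest-hd (r ∷ rs) = trans
    (cong₂ _+_ (trans (cong (_* r) e₂) (*-identityˡ r))
               (sum-tabulate-0 (λ u → cong (_* lookup rs u) (e₃ (toℕ u)))))
    (+-identityʳ r)

adjApply-path : ∀ {m} rx ry (r : Vec ℕ m) v →
  adjApply (2 + m) (rx ∷ ry ∷ r) (suc (suc v)) ≡ neighbours (rx + ry) r v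
adjApply-path {m} rx ry r v = begin
  adjApply (2 + m) (rx ∷ ry ∷ r) (suc (suc v))
    ≡⟨ adjApply-tabulate (2 + m) (rx ∷ ry ∷ r) (suc (suc v)) ⟩
  adjℕ (2 + toℕ v) 0 * rx + (adjℕ (2 + toℕ v) 1 * ry
    + sum (tabulate (λ u → adjℕ (2 + toℕ v) (2 + toℕ u) * lookup r u)))
    ≡⟨ cong (λ x → adjℕ (2 + toℕ v) 0 * rx + (adjℕ (2 + toℕ v) 1 * ry + x))
         (sum-tabulate-cong (λ u → cong (_* lookup r u) (adjℕ-path (toℕ v) (toℕ u)))) ⟩
  adjℕ (2 + toℕ v) 0 * rx + (adjℕ (2 + toℕ v) 1 * ry + pathSum (toℕ v) r)
    ≡⟨ cong₂ (λ x y → x * rx + (y * ry + pathSum (toℕ v) r)) (x-col (toℕ v)) (y-col (toℕ v)) ⟩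
  a * rx + (a * ry + pathSum (toℕ v) r)
    ≡⟨ factor a rx ry _ ⟩
  a * (rx + ry) + pathSum (toℕ v) r
    ≡⟨ neighbours-pathSum (rx + ry) r v ⟨
  neighbours (rx + ry) r v ∎
  where
  open ≡-Reasoning
  a = pathAdj (suc (toℕ v)) 0
  x-col : ∀ v → adjℕ (2 + v) 0 ≡ pathAdj (suc v) 0
  x-col zero    = refl
  x-col (suc _) = refl
  y-col : ∀ v → adjℕ (2 + v) 1 ≡ pathAdj (suc v) 0
  y-col zero    = refl
  y-col (suc _) = refl
  factor : ∀ a b c d → a * b + (a * c + d) ≡ a * (b + c) + d
  factor = solve-∀

-- Equivalence of chain and matrix equations

chain⇒equations : ∀ {m p} {d r : Vec ℕ m} → Chain p d r → ∀ v → lookup d v * lookup r v ≡ neighbours p r v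
chain⇒equations {d = _ ∷ _} {_ ∷ _} (eq , _)  zero    = eq
chain⇒equations {d = _ ∷ _} {_ ∷ _} (_  , ch) (suc v) = chain⇒equations ch v

equations⇒chain : ∀ {m p} {d r : Vec ℕ m} → (∀ v → lookup d v * lookup r v ≡ neighbours p r v) → Chain p d r
equations⇒chain {d = []}    {[]}    _   = tt
equations⇒chain {d = _ ∷ _} {_ ∷ _} eqs = eqs zero , equations⇒chain (eqs ∘ suc)

module _ {l dx dy rx ry : ℕ} {d r : Vec ℕ (suc l)} where

  IsArith⇒Core : IsArith (3 + l) (dx ∷ dy ∷ d , rx ∷ ry ∷ r) → Core dx dy d rx ry r
  IsArith⇒Core (_ , r-pos , eqs , prim) = core
    (trans (eqs zero) (adjApply-leaf rx ry r zero refl refl refl (λ _ → refl)))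
    (trans (eqs (suc zero)) (adjApply-leaf rx ry r (suc zero) refl refl refl (λ _ → refl)))
    (equations⇒chain (λ v → trans (eqs (suc (suc v))) (adjApply-path rx ry r v)))
    (r-pos zero)
    (r-pos (suc zero))
    (lookup⁻ (λ v → r-pos (suc (suc v))))
    (λ k k∣rx k∣ry k∣r → prim k (lookup⁺ {P = k ∣_} (k∣rx ∷ k∣ry ∷ k∣r)))

  Core⇒IsArith : Core dx dy d rx ry r → IsArith (3 + l) (dx ∷ dy ∷ d , rx ∷ ry ∷ r)
  Core⇒IsArith (core eqx eqy chain posx posy pos prim) =
    lookup⁺ (positive-factor (hd-pos pos) eqx ∷ positive-factor (hd-pos pos) eqy
             ∷ chain-positive (≤-trans posx (m≤m+n rx ry)) pos chain) ,
    lookup⁺ (posx ∷ posy ∷ pos) ,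
    (λ { zero          → trans eqx (sym (adjApply-leaf rx ry r zero refl refl refl (λ _ → refl)))
       ; (suc zero)    → trans eqy (sym (adjApply-leaf rx ry r (suc zero) refl refl refl (λ _ → refl)))
       ; (suc (suc v)) → trans (chain⇒equations chain v) (sym (adjApply-path rx ry r v)) }) ,
    (λ k k∣ → prim k (k∣ zero) (k∣ (suc zero)) (lookup⁻ (λ v → k∣ (suc (suc v)))))
    where
    hd-pos : ∀ {l} {r : Vec ℕ (suc l)} → All (1 ≤_) r → 1 ≤ hd r
    hd-pos (1≤r ∷ _) = 1≤r

-- Subdividing the path

bump : ∀ {m} → Vec ℕ m → Vec ℕ m
bump []       = []
bump (d ∷ ds) = suc d ∷ ds

-- Subdivides the edge after position `i`, or appends a vertex if `i` is last. The new vertex has d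
-- = 1, so its entry in `insertʳ` is the sum of the neighbouring entries; raising d at the
-- neighbours balances their equations.
insertᵈ : ∀ {m} → Fin m → Vec ℕ m → Vec ℕ (suc m)
insertᵈ zero    (d ∷ ds) = suc d ∷ 1 ∷ bump ds
insertᵈ (suc i) (d ∷ ds) = d ∷ insertᵈ i ds

insertʳ : ∀ {m} → Fin m → Vec ℕ m → Vec ℕ (suc m)
insertʳ zero    (r ∷ rs) = r ∷ r + hd rs ∷ rs
insertʳ (suc i) (r ∷ rs) = r ∷ insertʳ i rs

bump-injective : ∀ {m} {d e : Vec ℕ m} → bump d ≡ bump e → d ≡ e
bump-injective {d = []}    {[]}    _    = refl
bump-injective {d = _ ∷ _} {_ ∷ _} refl = refl

insertᵈ-injective : ∀ {m} (i : Fin m) {d e} → insertᵈ i d ≡ insertᵈ i e → d ≡ e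
insertᵈ-injective zero    {_ ∷ _} {_ ∷ _} eq =
  let d≡e , tails = ∷-injective eq in
  cong₂ _∷_ (suc-injective d≡e) (bump-injective (proj₂ (∷-injective tails)))
insertᵈ-injective (suc i) {_ ∷ _} {_ ∷ _} eq =
  let d≡e , tails = ∷-injective eq in cong₂ _∷_ d≡e (insertᵈ-injective i tails)

insertʳ-injective : ∀ {m} (i : Fin m) {r t} → insertʳ i r ≡ insertʳ i t → r ≡ t
insertʳ-injective zero    {_ ∷ _} {_ ∷ _} eq =
  let r≡t , tails = ∷-injective eq in cong₂ _∷_ r≡t (proj₂ (∷-injective tails))
insertʳ-injective (suc i) {_ ∷ _} {_ ∷ _} eq =
  let r≡t , tails = ∷-injective eq in cong₂ _∷_ r≡t (insertʳ-injective i tails)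

hd-insertʳ : ∀ {m} (i : Fin m) r → hd (insertʳ i r) ≡ hd r
hd-insertʳ zero    (_ ∷ _) = refl
hd-insertʳ (suc _) (_ ∷ _) = refl

-- The new entry is a sum of two old ones, or an old one plus 0. This serves for positivity and for
-- divisibility by k; the latter shows that subdivision keeps the common divisors.
All-insertʳ⁺ : ∀ {m} {P : ℕ → Set} → (∀ {l a} {rs : Vec ℕ l} → P a → All P rs → P (a + hd rs)) →
  (i : Fin m) {r : Vec ℕ m} → All P r → All P (insertʳ i r)
All-insertʳ⁺ add zero    (pr ∷ prs) = pr ∷ add pr prs ∷ prs
All-insertʳ⁺ add (suc i) (pr ∷ prs) = pr ∷ All-insertʳ⁺ add i prs

All-insertʳ⁻ : ∀ {m} {P : ℕ → Set} (i : Fin m) {r : Vec ℕ m} → All P (insertʳ i r) → All P r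
All-insertʳ⁻ zero    {_ ∷ _} (pr ∷ _ ∷ prs) = pr ∷ prs
All-insertʳ⁻ (suc i) {_ ∷ _} (pr ∷ prs)     = pr ∷ All-insertʳ⁻ i prs

∣-+-hd : ∀ k {l a} {rs : Vec ℕ l} → k ∣ a → All (k ∣_) rs → k ∣ a + hd rs
∣-+-hd k k∣a []        = ∣m∣n⇒∣m+n k∣a (k ∣0)
∣-+-hd k k∣a (k∣r ∷ _) = ∣m∣n⇒∣m+n k∣a k∣r

private
  grow : ∀ p h r {x} → x ≡ p + h → r + x ≡ p + (r + h)
  grow p h r eq = trans (cong (r +_) eq) (swap r p h)
    where
    swap : ∀ r p h → r + (p + h) ≡ p + (r + h)
    swap = solve-∀

  shrink : ∀ p h r {x} → r + x ≡ p + (r + h) → x ≡ p + h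
  shrink p h r {x} eq = +-cancelˡ-≡ r x (p + h) (trans eq (swap r p h))
    where
    swap : ∀ r p h → p + (r + h) ≡ r + (p + h)
    swap = solve-∀

-- The vertex behind the insertion sees p + r instead of p on its left; raising its d by one adds
-- the same r to the other side.
chain-bump⁺ : ∀ {m p} {d r : Vec ℕ m} → Chain p d r → Chain (p + hd r) (bump d) r
chain-bump⁺ {d = []}    {[]}         _         = tt
chain-bump⁺ {p = p} {d = _ ∷ _} {r ∷ rs} (eq , ch) =
  trans (grow p (hd rs) r eq) (sym (+-assoc p r (hd rs))) , ch

chain-bump⁻ : ∀ {m p} {d r : Vec ℕ m} → Chain (p + hd r) (bump d) r → Chain p d r
chain-bump⁻ {d = []}    {[]}         _         = tt
chain-bump⁻ {p = p} {d = _ ∷ _} {r ∷ rs} (eq , ch) =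
  shrink p (hd rs) r (trans eq (+-assoc p r (hd rs))) , ch

chain-insert⁺ : ∀ {m p} (i : Fin m) {d r} → Chain p d r → Chain p (insertᵈ i d) (insertʳ i r)
chain-insert⁺ {p = p} zero    {_ ∷ _} {r ∷ rs} (eq , ch) =
  grow p (hd rs) r eq , *-identityˡ _ , chain-bump⁺ ch
chain-insert⁺ {p = p} (suc i) {_ ∷ _} {_ ∷ rs} (eq , ch) =
  trans eq (cong (p +_) (sym (hd-insertʳ i rs))) , chain-insert⁺ i ch

chain-insert⁻ : ∀ {m p} (i : Fin m) {d r} → Chain p (insertᵈ i d) (insertʳ i r) → Chain p d r
chain-insert⁻ {p = p} zero    {_ ∷ _} {r ∷ rs} (eq , _ , ch) =
  shrink p (hd rs) r eq , chain-bump⁻ ch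
chain-insert⁻ {p = p} (suc i) {_ ∷ _} {_ ∷ rs} (eq , ch) =
  trans eq (cong (p +_) (hd-insertʳ i rs)) , chain-insert⁻ i ch

module _ {m dx dy rx ry : ℕ} (i : Fin m) {d r : Vec ℕ m} where

  Core-insert⁺ : Core dx dy d rx ry r → Core dx dy (insertᵈ i d) rx ry (insertʳ i r)
  Core-insert⁺ (core eqx eqy chain posx posy pos prim) = core
    (trans eqx (sym (hd-insertʳ i r))) (trans eqy (sym (hd-insertʳ i r)))
    (chain-insert⁺ i chain) posx posy
    (All-insertʳ⁺ (λ 1≤a _ → ≤-trans 1≤a (m≤m+n _ _)) i pos)
    (λ k k∣rx k∣ry k∣r → prim k k∣rx k∣ry (All-insertʳ⁻ i k∣r))

  Core-insert⁻ : Core dx dy (insertᵈ i d) rx ry (insertʳ i r) → Core dx dy d rx ry r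
  Core-insert⁻ (core eqx eqy chain posx posy pos prim) = core
    (trans eqx (hd-insertʳ i r)) (trans eqy (hd-insertʳ i r))
    (chain-insert⁻ i chain) posx posy
    (All-insertʳ⁻ i pos)
    (λ k k∣rx k∣ry k∣r → prim k k∣rx k∣ry (All-insertʳ⁺ (∣-+-hd k) i k∣r))

SmoothFrom : ∀ {m} → ℕ → Vec ℕ m → Set
SmoothFrom zero    d       = All (2 ≤_) d
SmoothFrom (suc k) []      = ⊤
SmoothFrom (suc k) (_ ∷ d) = SmoothFrom k d

SmoothFrom-suc : ∀ {m} k {d : Vec ℕ m} → SmoothFrom k d → SmoothFrom (suc k) d
SmoothFrom-suc k       {[]}    _       = tt
SmoothFrom-suc zero    {_ ∷ _} (_ ∷ s) = s
SmoothFrom-suc (suc k) {_ ∷ _} s       = SmoothFrom-suc k s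

SmoothFrom-length : ∀ {m} k (d : Vec ℕ m) → m ≤ k → SmoothFrom k d
SmoothFrom-length zero    []      _         = []
SmoothFrom-length (suc k) []      _         = tt
SmoothFrom-length (suc k) (_ ∷ d) (s≤s m≤k) = SmoothFrom-length k d m≤k

-- Position 2 + i now holds the right neighbour of the new vertex, its d raised from at least 1 to
-- at least 2. So the old d at position 1 + i may be any positive number.
SmoothFrom-insert⁺ : ∀ {m} (i : Fin m) {d} → All (1 ≤_) d →
  SmoothFrom (2 + toℕ i) d → SmoothFrom (2 + toℕ i) (insertᵈ i d)
SmoothFrom-insert⁺ zero    {_ ∷ []}    _             _ = []
SmoothFrom-insert⁺ zero    {_ ∷ _ ∷ _} (_ ∷ 1≤d ∷ _) s = s≤s 1≤d ∷ s
SmoothFrom-insert⁺ (suc i) {_ ∷ _}     (_ ∷ pos)     s = SmoothFrom-insert⁺ i pos s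

SmoothFrom-insert⁻ : ∀ {m} (i : Fin m) {d} →
  SmoothFrom (2 + toℕ i) (insertᵈ i d) → SmoothFrom (2 + toℕ i) d
SmoothFrom-insert⁻ zero    {_ ∷ []}    _       = tt
SmoothFrom-insert⁻ zero    {_ ∷ _ ∷ _} (_ ∷ s) = s
SmoothFrom-insert⁻ (suc i) {_ ∷ _}     s       = SmoothFrom-insert⁻ i s

¬SmoothFrom-insert : ∀ {m} (i : Fin m) {d} → ¬ SmoothFrom (1 + toℕ i) (insertᵈ i d)
¬SmoothFrom-insert zero    {_ ∷ _} (s≤s () ∷ _)
¬SmoothFrom-insert (suc i) {_ ∷ _} s = ¬SmoothFrom-insert i s

unbump : ∀ {m p} {d r : Vec ℕ m} → 1 ≤ p → Chain p d r → ∃ λ d′ → d ≡ bump d′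
unbump {d = []}                _   _        = [] , refl
unbump {d = zero ∷ _}  {_ ∷ _} (s≤s _) (() , _)
unbump {d = suc d ∷ ds} {_ ∷ _} _  _        = d ∷ ds , refl

-- If d = 1 at position 1 + i, the entry there is the sum of its neighbours. The equations force d ≥
-- 1 at these neighbours, so d can be lowered there.
smoothing : ∀ {m p} (i : Fin m) {d r} → 1 ≤ p → All (1 ≤_) r → Chain p d r →
  SmoothFrom (2 + toℕ i) d →
  SmoothFrom (1 + toℕ i) d ⊎ ∃₂ λ d′ r′ → d ≡ insertᵈ i d′ × r ≡ insertʳ i r′
smoothing zero {_ ∷ zero ∷ _} {_ ∷ _ ∷ _} _ (s≤s _ ∷ _) (_ , () , _) _
smoothing zero {zero ∷ suc zero ∷ _} {_ ∷ _ ∷ _} (s≤s _) _ (() , _) _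
smoothing zero {suc d ∷ suc zero ∷ ds} {r ∷ r₁ ∷ rs} _ (_ ∷ 1≤r₁ ∷ _) (_ , eq , ch) _
  with unbump 1≤r₁ ch
... | ds′ , refl = inj₂ (d ∷ ds′ , r ∷ rs , refl ,
  cong (λ x → r ∷ x ∷ rs) (trans (sym (*-identityˡ r₁)) eq))
smoothing zero {_ ∷ suc (suc _) ∷ _} {_ ∷ _ ∷ _} _ _ _ s = inj₁ (s≤s (s≤s z≤n) ∷ s)
smoothing (suc i) {d ∷ ds} {r ∷ rs} _ (1≤r ∷ pos) (_ , ch) s with smoothing i 1≤r pos ch s
... | inj₁ s′                      = inj₁ s′
... | inj₂ (ds′ , rs′ , refl , refl) = inj₂ (d ∷ ds′ , r ∷ rs′ , refl , refl)

-- The arithmetical structures on D_{2+m} with d_i ≥ 2 for all i > q; there is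
-- no condition on d_x and d_y.
TailSmooth : ∀ {m} → ℕ → Structure (2 + m) → Set
TailSmooth q (dx ∷ dy ∷ d , rx ∷ ry ∷ r) = Core dx dy d rx ry r × SmoothFrom (suc q) d

insert : ∀ {m} → Fin m → Structure (2 + m) → Structure (3 + m)
insert i (dx ∷ dy ∷ d , rx ∷ ry ∷ r) = dx ∷ dy ∷ insertᵈ i d , rx ∷ ry ∷ insertʳ i r

insert-injective : ∀ {m} (i : Fin m) {s t} → insert i s ≡ insert i t → s ≡ t
insert-injective i {_ ∷ _ ∷ _ , _ ∷ _ ∷ _} {_ ∷ _ ∷ _ , _ ∷ _ ∷ _} eq
  with ∷-injective (cong proj₁ eq) | ∷-injective (cong proj₂ eq)
... | refl , eqᵈ | refl , eqʳ
  with ∷-injective eqᵈ | ∷-injective eqʳ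
... | refl , eqᵈ′ | refl , eqʳ′
  with insertᵈ-injective i eqᵈ′ | insertʳ-injective i eqʳ′
... | refl | refl = refl

-- The two classes differ in d at v_{q+1}: at least 2, or 1. The index `i` of value q below m
-- guarantees that this vertex exists.
TailSmooth-split : ∀ {m} q (i : Fin m) → toℕ i ≡ q → ∀ {j k} →
  HasCard (TailSmooth {suc m} q) j → HasCard (TailSmooth {m} (suc q)) k → HasCard (TailSmooth {suc m} (suc q)) (j + k)
TailSmooth-split _ i refl cardⱼ cardₖ = HasCard-resp to from
  (HasCard-⊎ disjoint cardⱼ (HasCard-image (insert i) (insert-injective i) cardₖ))
  where
  Image : Structure _ → Set
  Image y = ∃ λ x → TailSmooth (suc (toℕ i)) x × y ≡ insert i x
  disjoint : ∀ y → TailSmooth (toℕ i) y → Image y → ⊥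
  disjoint _ (_ , s) ((_ ∷ _ ∷ _ , _ ∷ _ ∷ _) , _ , refl) = ¬SmoothFrom-insert i s
  to : ∀ y → TailSmooth (toℕ i) y ⊎ Image y → TailSmooth (suc (toℕ i)) y
  to (_ ∷ _ ∷ d , _ ∷ _ ∷ _) (inj₁ (c , s)) = c , SmoothFrom-suc (suc (toℕ i)) {d} s
  to _ (inj₂ ((_ ∷ _ ∷ _ , _ ∷ _ ∷ _) , (c , s) , refl)) =
    Core-insert⁺ i c ,
    SmoothFrom-insert⁺ i (chain-positive (≤-trans (posx c) (m≤m+n _ _)) (pos c) (chain c)) s
    where open Core
  from : ∀ y → TailSmooth (suc (toℕ i)) y → TailSmooth (toℕ i) y ⊎ Image y
  from (_ ∷ _ ∷ _ , _ ∷ _ ∷ _) (c , s)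
    with smoothing i (≤-trans (Core.posx c) (m≤m+n _ _)) (Core.pos c) (Core.chain c) s
  ... | inj₁ s′                    = inj₁ (c , s′)
  ... | inj₂ (_ , _ , refl , refl) =
    inj₂ (_ , (Core-insert⁻ i c , SmoothFrom-insert⁻ i s) , refl)

-- Smooth tails

down : ∀ n → Vec ℕ n
down zero    = []
down (suc n) = suc n ∷ down n

hd-down : ∀ n → hd (down n) ≡ n
hd-down zero    = refl
hd-down (suc n) = refl

chain-down⁺ : ∀ n → Chain (suc n) (replicate n 2) (down n)
chain-down⁺ zero    = tt
chain-down⁺ (suc n) =
  trans (double n) (cong (suc (suc n) +_) (sym (hd-down n))) , chain-down⁺ n
  where
  double : ∀ n → 2 * suc n ≡ suc (suc n) + n
  double = solve-∀

down-positive : ∀ n → All (1 ≤_) (down n)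
down-positive zero    = []
down-positive (suc n) = s≤s z≤n ∷ down-positive n

replicate-smooth : ∀ n → All (2 ≤_) (replicate n 2)
replicate-smooth zero    = []
replicate-smooth (suc n) = ≤-refl ∷ replicate-smooth n

-- Convexity: 2 r ≤ d r = p + r′ with r′ < r forces r < p.
chain-decreasing : ∀ {m p} {d r : Vec ℕ m} → 1 ≤ p → All (1 ≤_) r → All (2 ≤_) d → Chain p d r → hd r < p
chain-decreasing {d = []} {[]} 1≤p _ _ _ = 1≤p
chain-decreasing {p = p} {d ∷ ds} {r ∷ rs} _ (1≤r ∷ pos) (2≤d ∷ s) (eq , ch) =
  +-cancelʳ-< r r p (begin-strict
    r + r        ≡⟨ cong (r +_) (+-identityʳ r) ⟨
    2 * r        ≤⟨ *-monoˡ-≤ r 2≤d ⟩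
    d * r        ≡⟨ eq ⟩
    p + hd rs    <⟨ +-monoʳ-< p (chain-decreasing 1≤r pos s ch) ⟩
    p + r        ∎)
  where open ≤-Reasoning

-- Each equation gives the next entry as d r - p, so divisibility of two consecutive entries
-- propagates along the path.
chain-∣ : ∀ {m p} k {d r : Vec ℕ m} → k ∣ p → k ∣ hd r → Chain p d r → All (k ∣_) r
chain-∣ k {[]}     {[]}     _   _   _         = []
chain-∣ k {d ∷ _}  {r ∷ _}  k∣p k∣r (eq , ch) =
  k∣r ∷ chain-∣ k k∣r (∣m+n∣m⇒∣n (subst (k ∣_) eq (∣n⇒∣m*n d k∣r)) k∣p) ch

-- Let r be the first entry, r + 1 the one before it and h the one after it. Since h < r, the
-- equation d r = r + 1 + h < 3 r forces d = 2 and h = r - 1: the entries keep falling by 1.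
chain-down⁻ : ∀ {l} k {d r : Vec ℕ l} → hd r ≡ k → All (1 ≤_) r → All (2 ≤_) d →
  Chain (suc k) d r → l ≡ k × d ≡ replicate l 2 × r ≡ down l
-- As `hd []` is 0, the path ends exactly where the progression reaches 0, which ties its length to
-- k.
chain-down⁻ k {[]} {[]} refl _ _ _ = refl , refl , refl
chain-down⁻ zero {_ ∷ _} {_ ∷ _} refl (() ∷ _) _ _
chain-down⁻ (suc k) {suc zero ∷ _} {_ ∷ _} _ _ (s≤s () ∷ _) _
chain-down⁻ (suc k) {suc (suc zero) ∷ ds} {_ ∷ rs} refl (_ ∷ pos) (_ ∷ s) (eq , ch)
  with chain-down⁻ k (sym (+-cancelˡ-≡ (suc (suc k)) k (hd rs) (trans (double k) eq))) pos s ch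
  where
  double : ∀ n → suc (suc n) + n ≡ 2 * suc n
  double = solve-∀
... | refl , refl , refl = refl , refl , refl
chain-down⁻ (suc k) {suc (suc (suc e)) ∷ ds} {_ ∷ rs} refl (_ ∷ pos) (_ ∷ s) (eq , ch) =
  ⊥-elim (<-irrefl (sym eq) (begin-strict
    suc (suc k) + hd rs              <⟨ +-monoʳ-< (suc (suc k)) (chain-decreasing (s≤s z≤n) pos s ch) ⟩
    suc (suc k) + suc k              ≤⟨ m≤m+n _ k ⟩
    suc (suc k) + suc k + k          ≡⟨ triple k ⟩
    3 * suc k                        ≤⟨ *-monoˡ-≤ (suc k) (m≤m+n 3 e) ⟩
    (3 + e) * suc k                  ∎))
  where
  open ≤-Reasoning
  triple : ∀ k → suc (suc k) + suc k + k ≡ 3 * suc k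
  triple = solve-∀

-- From d_x = 1 follows r_x = r₀. With r_y ≤ r₀ and h = `hd rs` < r₀, the equation d₀ r₀ = r₀ + r_y
-- + h forces d₀ = 2 and r₀ = r_y + h. Then r_y divides r₀ and h, hence every entry, so r_y = 1 and
-- h = r₀ - 1; `chain-down⁻` does the rest.
rigid : ∀ {l d₀ dy rx ry r₀} {ds rs : Vec ℕ l} →
  Core 1 dy (d₀ ∷ ds) rx ry (r₀ ∷ rs) → All (2 ≤_) ds →
  (dy ≡ suc l × d₀ ≡ 2 × ds ≡ replicate l 2) × (rx ≡ suc l × ry ≡ 1 × r₀ ≡ suc l × rs ≡ down l)
rigid {l} {d₀} {dy} {rx} {ry} {r₀} {ds} {rs} (core eqx eqy (eq₀ , ch) posx posy (1≤r₀ ∷ pos) prim) s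
  with trans (sym (*-identityˡ rx)) eqx
... | refl = finish (d₀≡2 d₀ eq₀)
  where
  h : ℕ
  h = hd rs
  h<r₀ : h < rx
  h<r₀ = chain-decreasing 1≤r₀ pos s ch
  ry≤r₀ : ry ≤ rx
  ry≤r₀ = begin
    ry       ≡⟨ *-identityˡ ry ⟨
    1 * ry   ≤⟨ *-monoˡ-≤ ry (positive-factor {dy} 1≤r₀ eqy) ⟩
    dy * ry  ≡⟨ eqy ⟩
    rx       ∎
    where open ≤-Reasoning
  d₀≡2 : ∀ d → d * rx ≡ rx + ry + h → d ≡ 2 × rx ≡ ry + h
  d₀≡2 zero eq = ⊥-elim (<-irrefl eq (≤-trans posx (≤-trans (m≤m+n rx ry) (m≤m+n (rx + ry) h))))
  d₀≡2 (suc zero) eq = ⊥-elim (<-irrefl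
    (+-cancelˡ-≡ rx 0 (ry + h) (trans eq (+-assoc rx ry h)))
    (≤-trans posy (m≤m+n ry h)))
  d₀≡2 (suc (suc zero)) eq =
    refl , trans (sym (+-identityʳ rx)) (+-cancelˡ-≡ rx (rx + 0) (ry + h) (trans eq (+-assoc rx ry h)))
  d₀≡2 (suc (suc (suc e))) eq = ⊥-elim (<-irrefl (sym eq) (begin-strict
    rx + ry + h             <⟨ +-mono-≤-< (+-monoʳ-≤ rx ry≤r₀) h<r₀ ⟩
    rx + rx + rx            ≡⟨ triple rx ⟩
    3 * rx                  ≤⟨ *-monoˡ-≤ rx (m≤m+n 3 e) ⟩
    (3 + e) * rx            ∎))
    where
    open ≤-Reasoning
    triple : ∀ k → k + k + k ≡ 3 * k
    triple = solve-∀
  finish : d₀ ≡ 2 × rx ≡ ry + h →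
    (dy ≡ suc l × d₀ ≡ 2 × ds ≡ replicate l 2) × (rx ≡ suc l × ry ≡ 1 × rx ≡ suc l × rs ≡ down l)
  finish (d≡2 , rx≡) = (trans dy≡rx rx≡1+l , d≡2 , proj₁ (proj₂ tail)) ,
                       (rx≡1+l , ry≡1 , rx≡1+l , proj₂ (proj₂ tail))
    where
    ry∣rx : ry ∣ rx
    ry∣rx = divides dy (sym eqy)
    ry∣h : ry ∣ h
    ry∣h = ∣m+n∣m⇒∣n (subst (ry ∣_) rx≡ ry∣rx) ∣-refl
    ry≡1 : ry ≡ 1
    ry≡1 = prim ry ry∣rx ∣-refl (ry∣rx ∷ chain-∣ ry ry∣rx ry∣h ch)
    rx≡1+h : rx ≡ suc h
    rx≡1+h = trans rx≡ (cong (_+ h) ry≡1)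
    tail : l ≡ h × ds ≡ replicate l 2 × rs ≡ down l
    tail = chain-down⁻ h refl pos s (subst (λ p → Chain p ds rs) rx≡1+h ch)
    rx≡1+l : rx ≡ suc l
    rx≡1+l = trans rx≡1+h (cong suc (sym (proj₁ tail)))
    dy≡rx : dy ≡ rx
    dy≡rx = trans (sym (*-identityʳ dy)) (trans (cong (dy *_) (sym ry≡1)) eqy)

-- Smooth tails with d = 1 at a leaf

Core-swap : ∀ {m dx dy rx ry} {d r : Vec ℕ m} → Core dx dy d rx ry r → Core dy dx d ry rx r
Core-swap {rx = rx} {ry} {d} {r} (core eqx eqy chain posx posy pos prim) =
  core eqy eqx (subst (λ p → Chain p d r) (+-comm rx ry) chain) posy posx pos
    (λ k k∣ry k∣rx k∣r → prim k k∣rx k∣ry k∣r)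

-- The only structures with smooth tail and d = 1 at a leaf. They coincide for l = 0.
extraˣ extraʸ : ∀ l → Structure (3 + l)
extraˣ l = 1 ∷ suc l ∷ replicate (suc l) 2 , suc l ∷ 1 ∷ down (suc l)
extraʸ l = suc l ∷ 1 ∷ replicate (suc l) 2 , 1 ∷ suc l ∷ down (suc l)

extraʸ-Core : ∀ l → Core (suc l) 1 (replicate (suc l) 2) 1 (suc l) (down (suc l))
extraʸ-Core l = core (*-identityʳ (suc l)) (*-identityˡ (suc l)) (chain-down⁺ (suc l))
  (s≤s z≤n) (s≤s z≤n) (down-positive (suc l)) (λ k k∣1 _ _ → ∣1⇒≡1 k∣1)

TailSmooth-extraˣ : ∀ l → TailSmooth 0 (extraˣ l)
TailSmooth-extraˣ l = Core-swap (extraʸ-Core l) , replicate-smooth l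

TailSmooth-extraʸ : ∀ l → TailSmooth 0 (extraʸ l)
TailSmooth-extraʸ l = extraʸ-Core l , replicate-smooth l

rigidˣ : ∀ {l dy rx ry} {d r : Vec ℕ (suc l)} → TailSmooth 0 (1 ∷ dy ∷ d , rx ∷ ry ∷ r) →
  (1 ∷ dy ∷ d , rx ∷ ry ∷ r) ≡ extraˣ l
rigidˣ {d = _ ∷ _} {_ ∷ _} (c , s) with rigid c s
... | (refl , refl , refl) , (refl , refl , refl , refl) = refl

rigidʸ : ∀ {l dx rx ry} {d r : Vec ℕ (suc l)} → TailSmooth 0 (dx ∷ 1 ∷ d , rx ∷ ry ∷ r) →
  (dx ∷ 1 ∷ d , rx ∷ ry ∷ r) ≡ extraʸ l
rigidʸ {d = _ ∷ _} {_ ∷ _} (c , s) with rigid (Core-swap c) s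
... | (refl , refl , refl) , (refl , refl , refl , refl) = refl

leaf-cases : ∀ {l} {x : Structure (3 + l)} → TailSmooth 0 x →
  (x ≡ extraˣ l ⊎ x ≡ extraʸ l) ⊎
  (2 ≤ lookup (proj₁ x) zero × 2 ≤ lookup (proj₁ x) (suc zero))
leaf-cases {x = zero ∷ _ ∷ _ , _ ∷ _ ∷ _} (c , _) =
  ⊥-elim (<-irrefl refl (proj₁ (Core⇒IsArith c) zero))
leaf-cases {x = suc zero ∷ _ ∷ _ , _ ∷ _ ∷ _} t = inj₁ (inj₁ (rigidˣ t))
leaf-cases {x = suc (suc _) ∷ zero ∷ _ , _ ∷ _ ∷ _} (c , _) =
  ⊥-elim (<-irrefl refl (proj₁ (Core⇒IsArith c) (suc zero)))
leaf-cases {x = suc (suc _) ∷ suc zero ∷ _ , _ ∷ _ ∷ _} t = inj₁ (inj₂ (rigidʸ t))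
leaf-cases {x = suc (suc _) ∷ suc (suc _) ∷ _ , _} _ = inj₂ (s≤s (s≤s z≤n) , s≤s (s≤s z≤n))

module _ {l : ℕ} where

  smooth⇒TailSmooth : ∀ x → IsSmoothArith (3 + l) x → TailSmooth 0 x
  smooth⇒TailSmooth (_ ∷ _ ∷ _ ∷ _ , _ ∷ _ ∷ _) (arith , s) =
    IsArith⇒Core arith , lookup⁻ (λ v → s (suc (suc (suc v))) (λ ()))

  smooth⇒2≤ : ∀ x → IsSmoothArith (3 + l) x →
    2 ≤ lookup (proj₁ x) zero × 2 ≤ lookup (proj₁ x) (suc zero)
  smooth⇒2≤ _ (_ , s) = s zero (λ ()) , s (suc zero) (λ ())

  TailSmooth⇒smooth : ∀ x → TailSmooth 0 x →
    2 ≤ lookup (proj₁ x) zero → 2 ≤ lookup (proj₁ x) (suc zero) → IsSmoothArith (3 + l) x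
  TailSmooth⇒smooth (_ ∷ _ ∷ _ ∷ _ , _ ∷ _ ∷ _) (c , s) 2≤dx 2≤dy =
    Core⇒IsArith c ,
    (λ { zero                _   → 2≤dx
       ; (suc zero)          _   → 2≤dy
       ; (suc (suc zero))    v≢2 → ⊥-elim (v≢2 refl)
       ; (suc (suc (suc v))) _   → lookup⁺ s v })

TailSmooth-smooth : ∀ l {k} → HasCard (IsSmoothArith (4 + l)) k → HasCard (TailSmooth {2 + l} 0) (2 + k)
TailSmooth-smooth l card = HasCard-resp to from (HasCard-⊎ disjoint (HasCard-pair (λ ())) card)
  where
  to : ∀ x → (x ≡ extraˣ (suc l) ⊎ x ≡ extraʸ (suc l)) ⊎ IsSmoothArith (4 + l) x → TailSmooth 0 x
  to _ (inj₁ (inj₁ refl)) = TailSmooth-extraˣ (suc l)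
  to _ (inj₁ (inj₂ refl)) = TailSmooth-extraʸ (suc l)
  to x (inj₂ smooth)      = smooth⇒TailSmooth x smooth
  from : ∀ x → TailSmooth 0 x → (x ≡ extraˣ (suc l) ⊎ x ≡ extraʸ (suc l)) ⊎ IsSmoothArith (4 + l) x
  from x t with leaf-cases t
  ... | inj₁ extra         = inj₁ extra
  ... | inj₂ (2≤dx , 2≤dy) = inj₂ (TailSmooth⇒smooth x t 2≤dx 2≤dy)
  disjoint : ∀ x → x ≡ extraˣ (suc l) ⊎ x ≡ extraʸ (suc l) → IsSmoothArith (4 + l) x → ⊥
  disjoint x (inj₁ refl) smooth with smooth⇒2≤ x smooth
  ... | s≤s () , _
  disjoint x (inj₂ refl) smooth with smooth⇒2≤ x smooth
  ... | _ , s≤s ()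

-- The base case D₃

smoothD₃ : Structure 3
smoothD₃ = 2 ∷ 2 ∷ 1 ∷ [] , 1 ∷ 1 ∷ 2 ∷ []

-- From d_x, d_y ≥ 2 follow 2 r_x ≤ r₀ and 2 r_y ≤ r₀, so d₀ r₀ = r_x + r_y ≤ r₀. Hence d₀ = 1 and
-- both bounds are equalities; r_x = r_y divides every entry and is therefore 1.
rigidD₃ : ∀ {dx dy d₀ rx ry r₀} → 2 ≤ dx → 2 ≤ dy → Core dx dy (d₀ ∷ []) rx ry (r₀ ∷ []) →
  (dx ∷ dy ∷ d₀ ∷ [] , rx ∷ ry ∷ r₀ ∷ []) ≡ smoothD₃
rigidD₃ {dx} {dy} {d₀} {rx} {ry} {r₀} 2≤dx 2≤dy (core eqx eqy (eq₀ , _) posx posy _ prim) =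
  finish d₀ (trans eq₀ (+-identityʳ (rx + ry)))
  where
  half : ∀ {d r} → 2 ≤ d → d * r ≡ r₀ → r + r ≤ r₀
  half {d} {r} 2≤d eq = begin
    r + r   ≡⟨ cong (r +_) (+-identityʳ r) ⟨
    2 * r   ≤⟨ *-monoˡ-≤ r 2≤d ⟩
    d * r   ≡⟨ eq ⟩
    r₀      ∎
    where open ≤-Reasoning
  finish : ∀ d → d * r₀ ≡ rx + ry → (dx ∷ dy ∷ d ∷ [] , rx ∷ ry ∷ r₀ ∷ []) ≡ smoothD₃
  finish zero eq = ⊥-elim (<-irrefl eq (≤-trans posx (m≤m+n rx ry)))
  finish (suc zero) eq = equal (≤-antisym rx≤ry ry≤rx)
    where
    r₀≡ : r₀ ≡ rx + ry
    r₀≡ = trans (sym (+-identityʳ r₀)) eq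
    rx≤ry : rx ≤ ry
    rx≤ry = +-cancelˡ-≤ rx rx ry (≤-trans (half 2≤dx eqx) (≤-reflexive r₀≡))
    ry≤rx : ry ≤ rx
    ry≤rx = +-cancelʳ-≤ ry ry rx (≤-trans (half 2≤dy eqy) (≤-reflexive r₀≡))
    equal : rx ≡ ry → (dx ∷ dy ∷ 1 ∷ [] , rx ∷ ry ∷ r₀ ∷ []) ≡ smoothD₃
    equal refl with prim rx ∣-refl ∣-refl (divides dx (sym eqx) ∷ []) | r₀≡
    ... | refl | refl with trans (sym (*-identityʳ dx)) eqx | trans (sym (*-identityʳ dy)) eqy
    ... | refl | refl = refl
  finish (suc (suc e)) eq = ⊥-elim (<-irrefl (sym eq) (begin-strict
    rx + ry              <⟨ +-mono-< (<-≤-trans (m<m+n rx posx) (half 2≤dx eqx))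
                                     (<-≤-trans (m<m+n ry posy) (half 2≤dy eqy)) ⟩
    r₀ + r₀              ≡⟨ cong (r₀ +_) (+-identityʳ r₀) ⟨
    2 * r₀               ≤⟨ *-monoˡ-≤ r₀ (m≤m+n 2 e) ⟩
    (2 + e) * r₀         ∎))
    where open ≤-Reasoning

TailSmooth-D₃ : HasCard (TailSmooth {1} 0) 2
TailSmooth-D₃ = HasCard-resp to from (HasCard-pair {a = extraˣ 0} {smoothD₃} (λ ()))
  where
  to : ∀ x → x ≡ extraˣ 0 ⊎ x ≡ smoothD₃ → TailSmooth 0 x
  to _ (inj₁ refl) = TailSmooth-extraˣ 0
  to _ (inj₂ refl) =
    core refl refl (refl , tt) (s≤s z≤n) (s≤s z≤n) (s≤s z≤n ∷ []) (λ k k∣1 _ _ → ∣1⇒≡1 k∣1) , []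
  from : ∀ x → TailSmooth 0 x → x ≡ extraˣ 0 ⊎ x ≡ smoothD₃
  from (_ ∷ _ ∷ _ ∷ [] , _ ∷ _ ∷ _ ∷ []) t@(c , _) with leaf-cases t
  ... | inj₁ (inj₁ eq)     = inj₁ eq
  -- `extraʸ 0` and `extraˣ 0` are equal by computation.
  ... | inj₁ (inj₂ eq)     = inj₁ eq
  ... | inj₂ (2≤dx , 2≤dy) = inj₂ (rigidD₃ 2≤dx 2≤dy c)

-- Counting along the ballot recurrence

TailSmooth-triangle : ∀ n s → (∀ m → 4 ≤ m → m ≤ n → HasCard (IsSmoothArith m) (s m)) →
  ∀ q c {m} → m ≡ q + c → 1 ≤ m → 2 + m ≤ n →
  HasCard (TailSmooth {m} q) (triangle (λ i → 2 + smoothCount s i) q c)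
-- Entry (0, 0) would be a bident without v₀, which 1 ≤ m excludes.
TailSmooth-triangle n s cards zero zero refl () _
TailSmooth-triangle n s cards zero (suc zero) refl _ _ = TailSmooth-D₃
TailSmooth-triangle n s cards zero (suc (suc c)) refl _ 4+c≤n =
  TailSmooth-smooth c (cards (4 + c) (m≤m+n 4 c) 4+c≤n)
TailSmooth-triangle n s cards (suc q) zero {m} m≡ 1≤m bound =
  HasCard-resp widen narrow (TailSmooth-triangle n s cards q 1 m≡q+1 1≤m bound)
  where
  m≡q+1 : m ≡ q + 1
  m≡q+1 = trans m≡ (sym (+-suc q 0))
  widen : ∀ x → TailSmooth q x → TailSmooth (suc q) x
  widen (_ ∷ _ ∷ d , _ ∷ _ ∷ _) (c , s) = c , SmoothFrom-suc (suc q) {d} s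
  narrow : ∀ x → TailSmooth (suc q) x → TailSmooth q x
  narrow (_ ∷ _ ∷ d , _ ∷ _ ∷ _) (c , _) =
    c , SmoothFrom-length (suc q) d (≤-reflexive (trans m≡ (+-identityʳ (suc q))))
TailSmooth-triangle n s cards (suc q) (suc c) refl 1≤m bound =
  TailSmooth-split q (fromℕ< q<q+1+c) (toℕ-fromℕ< q<q+1+c)
    (TailSmooth-triangle n s cards q (2 + c) (sym (+-suc q (suc c))) 1≤m bound)
    (TailSmooth-triangle n s cards (suc q) c (+-suc q c) (≤-trans (s≤s z≤n) q<q+1+c)
      (≤-trans (n≤1+n _) bound))
  where
  q<q+1+c : q < q + suc c
  q<q+1+c = m<m+n q (s≤s z≤n)

theorem2p12 : (n : ℕ) → 3 ≤ n → (s : ℕ → ℕ) →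
    ((m : ℕ) → 4 ≤ m → m ≤ n → HasCard (IsSmoothArith m) (s m)) →
    HasCard (IsArith n) (2 * catalan (n ∸ 2) + sum4to n (λ m → ballot (n ∸ 3) (n ∸ m) * s m))
theorem2p12 (suc (suc (suc j))) (s≤s (s≤s (s≤s z≤n))) s cards =
  -- With n = j + 3 the path ends at v_j, so the entry in row j + 1, column 0 counts all structures.
  subst (HasCard (IsArith (3 + j))) (triangle-bident s j)
    (HasCard-resp to from
      (TailSmooth-triangle (3 + j) s cards (suc j) 0 (sym (+-identityʳ (suc j))) (s≤s z≤n) ≤-refl))
  where
  to : ∀ x → TailSmooth (suc j) x → IsArith (3 + j) x
  to (_ ∷ _ ∷ _ , _ ∷ _ ∷ _) (c , _) = Core⇒IsArith c
  from : ∀ x → IsArith (3 + j) x → TailSmooth (suc j) x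
  from (_ ∷ _ ∷ d , _ ∷ _ ∷ _) arith = IsArith⇒Core arith , SmoothFrom-length (2 + j) d (n≤1+n (suc j))
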